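{- Let $(\tau_\Sigma,\mathbb{B}_\Sigma)_\Sigma$ be a family indexed by finite sets $\Sigma$ with at least two elements, where $\tau_\Sigma$ is a topology on $T_\Sigma^\omega$ and $\mathbb{B}_\Sigma$ a basis of $\tau_\Sigma$, satisfying: (P1) $\mathbb{B}_\Sigma$ contains every basic clopen set $N_t$, $t$ a finite $\Sigma$-labelled binary tree; (P2) $\mathbb{B}_\Sigma$ is closed under finite unions and intersections; (P3) if $\Gamma$ is a finite set with at least two elements and $L\in\mathbb{B}_{\Sigma\times\Gamma}$ then $\pi_0[L]\in\mathbb{B}_\Sigma$; (P4) for each $L\in\mathbb{B}_\Sigma$ there is $C\in\mathbb{B}_{\Sigma\times 2}$ with $C\subseteq T_\Sigma^\omega\times\mathbb{T}_\infty$, $C$ the intersection of a closed subset of $T_\Sigma^\omega\times T_2^\omega$ with $T_\Sigma^\omega\times\mathbb{T}_\infty$, and $L=\pi_0[C]$. Then every $\tau_\Sigma$ is strong Choquet.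
   Context: $T_\Sigma^\omega$ is the set of functions $t:\{l,r\}^*\to\Sigma$ (infinite binary $\Sigma$-labelled trees) with the Cantor topology given by the distance $2^{ -n}$, $n$ the least length of a node where two trees differ. A finite tree is a map $s:S\to\Sigma$ with $S\subseteq\{l,r\}^*$ finite and prefix-closed; $N_s$ is the set of $t\in T_\Sigma^\omega$ extending $s$. $T_{\Sigma\times\Gamma}^\omega$ is identified with $T_\Sigma^\omega\times T_\Gamma^\omega$ nodewise and $\pi_0$ is the first projection. A path of $t$ is the sequence of labels $t(u_0)t(u_1)\cdots$ along an infinite branch $u_0\sqsubset u_1\sqsubset\cdots$ with $u_0$ the root and each $u_{i+1}$ a child of $u_i$. $2=\{0,1\}$ and $\mathbb{T}_\infty$ is the set of $t\in T_2^\omega$ such that every path of $t$ contains infinitely many $1$'s. Strong Choquet: nonempty and Player 2 has a winning strategy in the strong Choquet game (Player 1 plays open $U_i\ni x_i$ with $U_i\subseteq V_{i-1}$, Player 2 plays open $V_i$ with $x_i\in V_i\subseteq U_i$, Player 2 wins if $\bigcap_iV_i\neq\emptyset$). -}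

module Defs where

open import Data.Fin.Base using (Fin)
open import Data.Fin.Patterns using (1F)
open import Data.Fin.Properties using (*↔×)
open import Data.List.Base using (List; []; _∷ʳ_; length; applyDownFrom)
open import Data.List.Membership.Propositional using () renaming (_∈_ to _∈ₗ_)
open import Data.List.Relation.Binary.Prefix.Heterogeneous using (Prefix)
open import Data.Nat.Base using (ℕ; suc; _*_; _≤_; z≤n; s≤s)
open import Data.Nat.Properties using (≤-refl; ≤-trans; *-mono-≤)
open import Data.Product.Base using (Σ; ∃; _×_; _,_; proj₁; proj₂)
open import Data.Product.Function.NonDependent.Propositional using (_×-↔_)
open import Function.Base using (_∘_)
open import Function.Bundles using (_↔_)
open import Function.Construct.Composition using (_↔-∘_)
open import Function.Construct.Identity using (↔-id)
open import Function.Construct.Symmetry using (↔-sym)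
open import Level using (Level; 0ℓ) renaming (suc to lsuc)
open import Relation.Binary.Definitions using (_Respects_)
open import Relation.Binary.PropositionalEquality using (_≡_; _≗_)
open import Relation.Unary using (Pred; _∈_; _⊆_; _≐_; _∩_; ⋃; ∁; ∅; U)

1ℓ : Level
1ℓ = lsuc 0ℓ

------------------------------------------------------------------------
-- Finite sets with at least two elements

IsAlphabet : Set → Set
IsAlphabet A = ∃ λ n → 2 ≤ n × (A ↔ Fin n)

𝟚 : Set
𝟚 = Fin 2

𝟚-alphabet : IsAlphabet 𝟚
𝟚-alphabet = 2 , ≤-refl , ↔-id 𝟚

infixr 2 _×-alphabet_

_×-alphabet_ : ∀ {A B : Set} → IsAlphabet A → IsAlphabet B → IsAlphabet (A × B)
(m , 2≤m , f) ×-alphabet (n , 2≤n , g) =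
  m * n , ≤-trans (s≤s (s≤s z≤n)) (*-mono-≤ 2≤m 2≤n) , (↔-sym *↔× ↔-∘ (f ×-↔ g))

------------------------------------------------------------------------
-- Trees

data Dir : Set where
  l r : Dir

-- Nodes are words read from the root: the children of u are u ∷ʳ l and u ∷ʳ r.
Node : Set
Node = List Dir

-- Two trees are the same when they are pointwise equal (_≗_).
Tree : Set → Set
Tree A = Node → A

TreeSet : Set → Set₁
TreeSet A = Pred (Tree A) 0ℓ

-- The label does not depend on the membership proof, so that it is a function
-- on the set of nodes listed in dom.
record FinTree (A : Set) : Set where
  field
    dom           : List Node
    prefix-closed : ∀ {u v} → Prefix _≡_ u v → v ∈ₗ dom → u ∈ₗ dom
    label         : (u : Node) → .(u ∈ₗ dom) → A

N : ∀ {A} → FinTree A → TreeSet A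
N s t = ∀ u (u∈dom : u ∈ₗ dom) → t u ≡ label u u∈dom
  where open FinTree s

-- With d(t , t′) = 2^{-k}, k the least length of a node where t and t′ differ,
-- this says d(t , t′) < 2^{-n}.
_≈[_]_ : ∀ {A} → Tree A → ℕ → Tree A → Set
t ≈[ n ] t′ = ∀ u → length u ≤ n → t u ≡ t′ u

CantorOpen : ∀ {A} → TreeSet A → Set
CantorOpen W = ∀ t → t ∈ W → ∃ λ n → ∀ t′ → t ≈[ n ] t′ → t′ ∈ W

CantorClosed : ∀ {A} → TreeSet A → Set
CantorClosed F = CantorOpen (∁ F)

-- A tree over A × B stands for the pair of trees (proj₁ ∘ t , proj₂ ∘ t).
π₀[_] : ∀ {A B} → TreeSet (A × B) → TreeSet A
π₀[ L ] t = ∃ λ s → s ∈ L × (proj₁ ∘ s ≗ t)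

record Branch : Set where
  field
    node  : ℕ → Node
    root  : node 0 ≡ []
    child : ∀ i → ∃ λ d → node (suc i) ≡ node i ∷ʳ d

𝕋∞ : TreeSet 𝟚
𝕋∞ t = (β : Branch) → ∀ n → ∃ λ m → n ≤ m × t (Branch.node β m) ≡ 1F

T×𝕋∞ : ∀ {A} → TreeSet (A × 𝟚)
T×𝕋∞ t = proj₂ ∘ t ∈ 𝕋∞

------------------------------------------------------------------------
-- Topologies on the set of trees

TreeSets : Set → Set₂
TreeSets A = Pred (TreeSet A) 1ℓ

-- The conditions resp-≗ and resp-≐ say that open sets are sets of trees up to
-- pointwise equality, and that τ is a collection of sets up to extensionality.
record IsTopology {A : Set} (τ : TreeSets A) : Set₁ where
  field
    resp-≗ : ∀ {V} → τ V → V Respects _≗_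
    resp-≐ : ∀ {V W} → V ≐ W → τ V → τ W
    empty  : τ ∅
    whole  : τ U
    inter  : ∀ {V W} → τ V → τ W → τ (V ∩ W)
    union  : ∀ (I : Set) (V : I → TreeSet A) → (∀ i → τ (V i)) → τ (⋃ I V)

record IsBasis {A : Set} (τ 𝔹 : TreeSets A) : Set₁ where
  field
    resp-≐ : ∀ {V W} → V ≐ W → 𝔹 V → 𝔹 W
    isOpen : ∀ {V} → 𝔹 V → τ V
    refine : ∀ {V} → τ V → ∀ t → t ∈ V → Σ (TreeSet A) λ W → 𝔹 W × t ∈ W × W ⊆ V

-- The irrelevant argument makes the value depend on the set A only, not on an
-- enumeration of it.
Family : Set₂
Family = (A : Set) → .(IsAlphabet A) → TreeSets A

------------------------------------------------------------------------
-- The strong Choquet game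

module StrongChoquetGame {A : Set} (τ : TreeSets A) where

  -- A move (Uᵢ , xᵢ) of Player 1.
  Move : Set₁
  Move = TreeSet A × Tree A

  -- A strategy of Player 2 answers the list of Player 1's moves so far, the
  -- latest move first.
  Strategy : Set₁
  Strategy = List Move → TreeSet A

  reply : Strategy → (ℕ → Move) → ℕ → TreeSet A
  reply σ p i = σ (applyDownFrom p (suc i))

  record Legal₁ (σ : Strategy) (p : ℕ → Move) (i : ℕ) : Set₁ where
    field
      isOpen : τ (proj₁ (p i))
      point  : proj₂ (p i) ∈ proj₁ (p i)
      inside : ∀ {j} → i ≡ suc j → proj₁ (p i) ⊆ reply σ p j

  record Legal₂ (σ : Strategy) (p : ℕ → Move) (i : ℕ) : Set₁ where
    field
      isOpen : τ (reply σ p i)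
      point  : proj₂ (p i) ∈ reply σ p i
      inside : reply σ p i ⊆ proj₁ (p i)

  -- Player 2 must answer legally as long as Player 1 has played legally.
  record Winning (σ : Strategy) : Set₁ where
    field
      legal : ∀ p i → (∀ j → j ≤ i → Legal₁ σ p j) → Legal₂ σ p i
      wins  : ∀ p → (∀ i → Legal₁ σ p i) → ∃ λ t → ∀ i → t ∈ reply σ p i

IsStrongChoquet : ∀ {A} → TreeSets A → Set₁
IsStrongChoquet {A} τ = Tree A × ∃ λ σ → Winning σ
  where open StrongChoquetGame τ

{-# OPTIONS --safe #-}

-- Player 2 keeps, for every move (Uᵢ , xᵢ) of Player 1, a set Cᵢ as in (P4) with
-- xᵢ ∈ π₀[Cᵢ] ⊆ Uᵢ, a tree zᵢ ∈ Cᵢ and a depth nᵢ, and answers the intersection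
-- of the projections of the sets of trees of Cⱼ that agree with zⱼ up to depth nⱼ,
-- j ≤ i.  By the rules each new point xᵢ lies in the projections of the previous
-- round, so every zⱼ can be replaced by a tree over xᵢ without changing it up to
-- depth nⱼ.  By compactness, since the 𝟚-component of zⱼ is in 𝕋∞, nⱼ can then be
-- increased so that every branch carries a 1 between the old and the new depth.
-- The zⱼ therefore converge within Cⱼ: the limit is in 𝕋∞ by the choice of depths
-- and in the closed set that defines Cⱼ.  All the limits lie over lim xᵢ.
module Submission where

open import Defs
open import Axiom.ExcludedMiddle using (ExcludedMiddle)
open import Data.Fin.Base using (Fin; zero; suc; fromℕ<)
open import Data.Fin.Patterns using (1F)
open import Data.List.Base using (List; []; _∷_; _∷ʳ_; _++_; length; map; applyDownFrom)
open import Data.List.Membership.Propositional using () renaming (_∈_ to _∈ₗ_)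
open import Data.List.Membership.Propositional.Properties
  using (∈-map⁺; ∈-map⁻; ∈-++⁺ˡ; ∈-++⁺ʳ; ∈-++⁻)
open import Data.List.Properties using (length-++)
open import Data.List.Relation.Binary.Prefix.Heterogeneous.Properties using (length-mono)
open import Data.List.Relation.Unary.Any using (here; there)
open import Data.Nat.Base using (ℕ; zero; suc; _+_; _∸_; _⊔_; _≤_; _<_; z≤n; s≤s)
open import Data.Nat.Properties
open import Data.Product.Base using (∃; _×_; _,_; proj₁; proj₂)
open import Data.Sum.Base using (inj₁; inj₂)
open import Function.Base using (_∘_)
open import Function.Bundles using (Inverse)
open import Level using (0ℓ; lift; lower)
open import Relation.Binary.PropositionalEquality
  using (_≡_; refl; sym; trans; cong; subst; _≗_; module ≡-Reasoning)
open import Relation.Nullary.Decidable.Core using (yes; no; map′; decidable-stable)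
open import Relation.Nullary.Negation.Core using (¬_; contradiction)
open import Relation.Unary using (Pred; _∈_; _⊆_; _≐_; _∩_; _∪_; ⋂; U)

lower-em : ExcludedMiddle 1ℓ → ExcludedMiddle 0ℓ
lower-em em = map′ lower lift em

-- Finite trees of bounded depth

nodes≤ : ℕ → List Node
nodes≤ zero    = [] ∷ []
nodes≤ (suc n) = [] ∷ map (l ∷_) (nodes≤ n) ++ map (r ∷_) (nodes≤ n)

∈-nodes≤⁺ : ∀ n {u} → length u ≤ n → u ∈ₗ nodes≤ n
∈-nodes≤⁺ zero    {[]}    _         = here refl
∈-nodes≤⁺ (suc n) {[]}    _         = here refl
∈-nodes≤⁺ (suc n) {l ∷ u} (s≤s u≤n) = there (∈-++⁺ˡ (∈-map⁺ (l ∷_) (∈-nodes≤⁺ n u≤n)))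
∈-nodes≤⁺ (suc n) {r ∷ u} (s≤s u≤n) =
  there (∈-++⁺ʳ (map (l ∷_) (nodes≤ n)) (∈-map⁺ (r ∷_) (∈-nodes≤⁺ n u≤n)))

∈-nodes≤⁻ : ∀ n {u} → u ∈ₗ nodes≤ n → length u ≤ n
∈-nodes≤⁻ zero    (here refl) = z≤n
∈-nodes≤⁻ (suc n) (here refl) = z≤n
∈-nodes≤⁻ (suc n) (there u∈)  with ∈-++⁻ (map (l ∷_) (nodes≤ n)) u∈
... | inj₁ u∈l with _ , v∈ , refl ← ∈-map⁻ (l ∷_) u∈l = s≤s (∈-nodes≤⁻ n v∈)
... | inj₂ u∈r with _ , v∈ , refl ← ∈-map⁻ (r ∷_) u∈r = s≤s (∈-nodes≤⁻ n v∈)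

-- `N (truncate n t)` is the ball of trees agreeing with `t` to depth `n`, in the form to which (P1)
-- applies.
truncate : ∀ {A} → ℕ → Tree A → FinTree A
truncate n t = record
  { dom           = nodes≤ n
  ; prefix-closed = λ u≼v v∈ → ∈-nodes≤⁺ n (≤-trans (length-mono u≼v) (∈-nodes≤⁻ n v∈))
  ; label         = λ u _ → t u
  }

truncate-refl : ∀ {A} n (t : Tree A) → t ∈ N (truncate n t)
truncate-refl n t u _ = refl

truncate⇒≈ : ∀ {A} n {t t′ : Tree A} → t′ ∈ N (truncate n t) → t ≈[ n ] t′
truncate⇒≈ n t′∈ u u≤n = sym (t′∈ u (∈-nodes≤⁺ n u≤n))

≈⇒truncate : ∀ {A} n {t t′ : Tree A} → t ≈[ n ] t′ → t′ ∈ N (truncate n t)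
≈⇒truncate n t≈t′ u u∈ = sym (t≈t′ u (∈-nodes≤⁻ n u∈))

-- Bars and compactness

-- A node has only two children, so an inductive bar has a finite height; compactness enters here.
data Bar (P : Pred Node 0ℓ) (u : Node) : Set where
  now   : P u → Bar P u
  later : (∀ d → Bar P (u ∷ʳ d)) → Bar P u

height : ∀ {P u} → Bar P u → ℕ
height {u = u} (now _)   = length u
height         (later b) = height (b l) ⊔ height (b r)

length-node : ∀ β i → length (Branch.node β i) ≡ i
length-node β zero    = cong length (Branch.root β)
length-node β (suc i) with d , eq ← Branch.child β i = begin
  length (node (suc i))  ≡⟨ cong length eq ⟩
  length (node i ∷ʳ d)   ≡⟨ length-++ (node i) ⟩
  length (node i) + 1    ≡⟨ +-comm (length (node i)) 1 ⟩
  suc (length (node i))  ≡⟨ cong suc (length-node β i) ⟩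
  suc i                  ∎
  where open ≡-Reasoning
        open Branch β

bar-meets : ∀ {P u} (b : Bar P u) β i → Branch.node β i ≡ u →
            ∃ λ m → P (Branch.node β m) × m ≤ height b
bar-meets (now p)   β i refl = i , p , ≤-reflexive (sym (length-node β i))
bar-meets (later b) β i eq
  with d , eq′ ← Branch.child β i
  with m , p , m≤ ← bar-meets (b d) β (suc i) (trans eq′ (cong (_∷ʳ d) eq))
  = m , p , ≤-trans m≤ (height≤ d)
  where
  height≤ : ∀ d → height (b d) ≤ height (b l) ⊔ height (b r)
  height≤ l = m≤m⊔n _ _
  height≤ r = m≤n⊔m _ _

OneBetween : ℕ → ℕ → TreeSet 𝟚
OneBetween n n′ y = ∀ β → ∃ λ m → n ≤ m × m ≤ n′ × y (Branch.node β m) ≡ 1F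

-- König's lemma: from an unbarred root, unbarred children could be picked forever, but the
-- resulting branch meets a 1 at depth at least `n`, which is a barred node.
𝕋∞⇒OneBetween : ExcludedMiddle 0ℓ → ∀ {y} → y ∈ 𝕋∞ → ∀ n →
                ∃ λ n′ → n < n′ × y ∈ OneBetween n n′
-- The bar may have height exactly `n`; the join with `suc n` makes the depth grow strictly.
𝕋∞⇒OneBetween em {y} y∈ n = suc n ⊔ height bar , m≤m⊔n (suc n) (height bar) , λ β →
  let m , (n≤ , one) , m≤ = bar-meets bar β 0 (Branch.root β)
  in m , subst (n ≤_) (length-node β m) n≤ , ≤-trans m≤ (m≤n⊔m (suc n) (height bar)) , one
  where
  B : Pred Node 0ℓ
  B = Bar λ u → n ≤ length u × y u ≡ 1F

  unbarred-child : ∀ {u} → ¬ B u → ∃ λ d → ¬ B (u ∷ʳ d)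
  unbarred-child ¬b = decidable-stable em λ none →
    ¬b (later λ d → decidable-stable em λ ¬bd → none (d , ¬bd))

  descend : ¬ B [] → ℕ → ∃ λ u → ¬ B u
  descend ¬b zero    = [] , ¬b
  descend ¬b (suc i) = let d , ¬bd = unbarred-child (proj₂ (descend ¬b i)) in _ , ¬bd

  branch : ¬ B [] → Branch
  branch ¬b = record
    { node  = proj₁ ∘ descend ¬b
    ; root  = refl
    ; child = λ i → proj₁ (unbarred-child (proj₂ (descend ¬b i))) , refl
    }

  bar : B []
  bar = decidable-stable em λ ¬b →
    let m , n≤m , one = y∈ (branch ¬b) n
    in proj₂ (descend ¬b m)
         (now (subst (n ≤_) (sym (length-node (branch ¬b) m)) n≤m , one))

-- Limits

-- A diagonal: if stage `k` is final up to a depth of at least `k`, the label at `u` is final at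
-- stage `length u`.
limit : ∀ {A} → (ℕ → Tree A) → Tree A
limit z u = z (length u) u

module Cauchy {A} (z : ℕ → Tree A) (d : ℕ → ℕ)
  (d-increasing : ∀ k → d k < d (suc k)) (z-cauchy : ∀ k → z k ≈[ d k ] z (suc k))
  where

  d-mono : ∀ j k → d k ≤ d (j + k)
  d-mono zero    k = ≤-refl
  d-mono (suc j) k = ≤-trans (d-mono j k) (<⇒≤ (d-increasing (j + k)))

  k≤dk : ∀ k → k ≤ d k
  k≤dk zero    = z≤n
  k≤dk (suc k) = ≤-trans (s≤s (k≤dk k)) (d-increasing k)

  stable : ∀ j k → z k ≈[ d k ] z (j + k)
  stable zero    k u _   = refl
  stable (suc j) k u u≤d =
    trans (stable j k u u≤d) (z-cauchy (j + k) u (≤-trans u≤d (d-mono j k)))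

  stable-≤ : ∀ {k m} → k ≤ m → z k ≈[ d k ] z m
  stable-≤ {k} {m} k≤m =
    subst (λ i → z k ≈[ d k ] z i) (m∸n+n≡m k≤m) (stable (m ∸ k) k)

  ≈-limit : ∀ k → z k ≈[ d k ] limit z
  -- The earlier of the stages `k` and `length u` agrees with the other one at `u`.
  ≈-limit k u u≤d with ≤-total k (length u)
  ... | inj₁ k≤u = stable-≤ k≤u u u≤d
  ... | inj₂ u≤k = sym (stable-≤ u≤k u (k≤dk (length u)))

  closed⇒limit∈ : ExcludedMiddle 0ℓ → ∀ {F} → CantorClosed F → (∀ k → z k ∈ F) →
                  limit z ∈ F
  closed⇒limit∈ em F-closed z∈F = decidable-stable em λ ∉F →
    let n , open-n = F-closed (limit z) ∉F
    in open-n (z n) (λ u u≤n → sym (≈-limit n u (≤-trans u≤n (k≤dk n)))) (z∈F n)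

-- The game

-- `π₀-open` keeps Player 2's answers open after a commitment to a finite part of a tree.
record Code {A : Set} (τ : TreeSets A) : Set₁ where
  field
    set         : TreeSet (A × 𝟚)
    hull        : TreeSet (A × 𝟚)
    hull-closed : CantorClosed hull
    set≐        : set ≐ hull ∩ T×𝕋∞
    π₀-open     : ∀ s → τ π₀[ set ∩ N s ]

module Strategy {A : Set} (τ : TreeSets A) (isTopology : IsTopology τ)
  (em : ExcludedMiddle 1ℓ)
  (encode : ∀ {O x} → τ O → x ∈ O →
            ∃ λ (c : Code τ) → x ∈ π₀[ Code.set c ] × π₀[ Code.set c ] ⊆ O)
  where

  open IsTopology isTopology
  open StrongChoquetGame τ
  open Code

  em₀ : ExcludedMiddle 0ℓ
  em₀ = lower-em em

  ⋂-open : ∀ n (V : Fin n → TreeSet A) → (∀ k → τ (V k)) → τ (⋂ (Fin n) V)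
  ⋂-open zero    V V-open = resp-≐ ((λ _ ()) , λ _ → _) whole
  ⋂-open (suc n) V V-open =
    resp-≐ ((λ { (v , vs) zero → v ; (v , vs) (suc k) → vs k }) ,
            λ vs → vs zero , vs ∘ suc)
           (inter (V-open zero) (⋂-open n (V ∘ suc) (V-open ∘ suc)))

  -- Evolution of a single code

  record State (c : Code τ) : Set where
    field
      tree  : Tree (A × 𝟚)
      tree∈ : tree ∈ set c
      depth : ℕ

  open State

  Committed : ∀ {c} → State c → TreeSet (A × 𝟚)
  Committed {c} s = set c ∩ N (truncate (depth s) (tree s))

  tree∈Committed : ∀ {c} (s : State c) → tree s ∈ Committed s
  tree∈Committed s = tree∈ s , truncate-refl (depth s) (tree s)

  -- `next-over` is conditional because a strategy also answers illegal histories, where `x` may lie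
  -- outside the projection.
  record Successor {c} (x : Tree A) (s : State c) : Set where
    field
      next        : State c
      next∈       : tree next ∈ Committed s
      next-over   : x ∈ π₀[ Committed s ] → proj₁ ∘ tree next ≗ x
      next-deeper : depth s < depth next
      next-ones   : proj₂ ∘ tree next ∈ OneBetween (depth s) (depth next)

  open Successor

  successor : ∀ {c} (x : Tree A) (s : State c) → Successor x s
  successor {c} x s =
    let z , z∈@(z∈c , _) , over = follow
        n′ , n<n′ , ones        =
          𝕋∞⇒OneBetween em₀ {proj₂ ∘ z} (proj₂ (proj₁ (set≐ c) z∈c)) (depth s)
    in record
         { next        = record { tree = z ; tree∈ = z∈c ; depth = n′ }
         ; next∈       = z∈
         ; next-over   = over
         ; next-deeper = n<n′
         ; next-ones   = ones
         }
    where
    -- Since ∃ is Σ, excluded middle for x ∈ π₀[ Committed s ] also chooses a preimage.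
    follow : ∃ λ z → z ∈ Committed s × (x ∈ π₀[ Committed s ] → proj₁ ∘ z ≗ x)
    follow with em₀ {x ∈ π₀[ Committed s ]}
    ... | yes (z , z∈ , z≗x) = z , z∈ , λ _ → z≗x
    ... | no x∉              = tree s , tree∈Committed s , λ x∈ → contradiction x∈ x∉

  evolve : ∀ {c} → Tree A → State c → State c
  evolve x s = next (successor x s)

  module Orbit {c} (s : State c) (q : ℕ → Tree A) where

    orbit : ℕ → State c
    orbit zero    = s
    orbit (suc n) = evolve (q n) (orbit n)

    step : ∀ n → Successor (q n) (orbit n)
    step n = successor (q n) (orbit n)

    open Cauchy (tree ∘ orbit) (depth ∘ orbit)
      (next-deeper ∘ step) (λ n → truncate⇒≈ (depth (orbit n)) (proj₂ (next∈ (step n))))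

    lim : Tree (A × 𝟚)
    lim = limit (tree ∘ orbit)

    -- Stage `suc n` has a 1 on each branch between the depths of stages `n` and `suc n`, and the
    -- limit agrees with it that far.
    lim∈T×𝕋∞ : lim ∈ T×𝕋∞
    lim∈T×𝕋∞ β n =
      let m , d≤m , m≤d′ , one = next-ones (step n) β
          node≤d′ = subst (_≤ depth (orbit (suc n))) (sym (length-node β m)) m≤d′
      in m , ≤-trans (k≤dk n) d≤m ,
         trans (sym (cong proj₂ (≈-limit (suc n) (Branch.node β m) node≤d′))) one

    lim∈Committed : lim ∈ Committed s
    lim∈Committed =
      proj₂ (set≐ c)
        ( closed⇒limit∈ em₀ (hull-closed c)
            (λ n → proj₁ (proj₁ (set≐ c) (tree∈ (orbit n))))
        , lim∈T×𝕋∞) ,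
      ≈⇒truncate (depth s) (≈-limit 0)

    -- Stage `suc n` lies over `q n` and agrees with the limit beyond depth `n`. The index that
    -- settles the label at `u` depends on `u` alone, so limits for different codes can be compared.
    lim-over : (∀ n → q n ∈ π₀[ Committed (orbit n) ]) →
               ∀ u n → length u ≤ n → q n u ≡ proj₁ (lim u)
    lim-over q∈ u n u≤n = trans
      (sym (next-over (step n) (q∈ n) u))
      (cong proj₁ (≈-limit (suc n) u (≤-trans (m≤n⇒m≤1+n u≤n) (k≤dk (suc n)))))

  -- The strategy: one evolving code per past move

  Thread : Set₁
  Thread = ∃ State

  Answer : Thread → TreeSet A
  Answer (_ , s) = π₀[ Committed s ]

  -- An illegal move is answered as if Player 1 had played the whole space.
  codeFor : ((O , x) : Move) → ∃ λ c → x ∈ π₀[ set c ] × (τ O → x ∈ O → π₀[ set c ] ⊆ O)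
  codeFor (O , x) with em {τ O × x ∈ O}
  ... | yes (O-open , x∈O) =
    let c , x∈ , c⊆O = encode O-open x∈O in c , x∈ , λ _ _ → c⊆O
  ... | no illegal =
    let c , x∈ , _ = encode {x = x} whole _
    in c , x∈ , λ O-open x∈O → contradiction (O-open , x∈O) illegal

  birth : Move → Thread
  birth move with c , (z , z∈ , _) , _ ← codeFor move =
    -- Any starting depth would do; 0 commits to the root label only.
    c , record { tree = z ; tree∈ = z∈ ; depth = 0 }

  birth-point : ∀ move → proj₂ move ∈ Answer (birth move)
  birth-point move with c , (z , z∈ , z≗x) , _ ← codeFor move =
    z , (z∈ , truncate-refl 0 z) , z≗x

  birth-inside : ∀ {O x} → τ O → x ∈ O → Answer (birth (O , x)) ⊆ O
  birth-inside {O} {x} O-open x∈O (z , (z∈ , _) , z≗t)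
    with _ , _ , c⊆O ← codeFor (O , x) = c⊆O O-open x∈O (z , z∈ , z≗t)

  -- Index `zero` belongs to the latest move. Only older threads evolve along its point, since the
  -- new one already lies over it.
  threads : (h : List Move) → Fin (length h) → Thread
  threads (move    ∷ h) zero    = birth move
  threads ((_ , x) ∷ h) (suc k) = let c , s = threads h k in c , evolve x s

  strategy : Strategy
  strategy h = ⋂ (Fin (length h)) (Answer ∘ threads h)

  evolve-point : ∀ {x} ((c , s) : Thread) → x ∈ Answer (c , s) →
                 x ∈ Answer (c , evolve x s)
  evolve-point {x} (c , s) x∈ =
    tree (evolve x s) , tree∈Committed (evolve x s) , next-over (successor x s) x∈

  -- Plays against the strategy

  module Play (p : ℕ → Move) where

    x : ℕ → Tree A
    x = proj₂ ∘ p

    history : ℕ → List Move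
    history = applyDownFrom p

    legal : ∀ i → (∀ j → j ≤ i → Legal₁ strategy p j) → Legal₂ strategy p i
    legal i legal₁ = record
      { isOpen = ⋂-open _ _ λ k →
                   let c , s = threads (history (suc i)) k in π₀-open c (truncate (depth s) (tree s))
      ; point  = λ { zero    → birth-point (p i)
                   ; (suc k) → evolve-point (threads (history i) k)
                                 (in-previous i legal₁ k) }
      ; inside = λ t∈ → birth-inside (isOpen legal-i) (point legal-i) (t∈ zero)
      }
      where
      open Legal₁
      legal-i = legal₁ i ≤-refl
      in-previous : ∀ i → (∀ j → j ≤ i → Legal₁ strategy p j) →
                    x i ∈ strategy (history i)
      in-previous zero    _      ()
      in-previous (suc i) legal₁ = inside (legal₁ (suc i) ≤-refl) refl
                                     (point (legal₁ (suc i) ≤-refl))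

    module Won (legal₁ : ∀ i → Legal₁ strategy p i) where

      x∈ : ∀ i → x i ∈ strategy (history i)
      x∈ zero    ()
      x∈ (suc i) = Legal₁.inside (legal₁ (suc i)) refl (Legal₁.point (legal₁ (suc i)))

      -- Each round shifts a thread's index by one, so its later states form an orbit. The order
      -- `n + i` lets `suc n + i` compute.
      module Track i (k : Fin (length (history i))) where

        aged : ∀ n → Fin (length (history (n + i)))
        aged zero    = k
        aged (suc n) = suc (aged n)

        open Orbit (proj₂ (threads (history i) k)) (λ n → x (n + i)) public

        threads-orbit : ∀ n → threads (history (n + i)) (aged n) ≡ (_ , orbit n)
        threads-orbit zero    = refl
        threads-orbit (suc n) =
          cong (λ (c , s) → c , evolve (x (n + i)) s) (threads-orbit n)

        lim≡ : ∀ u m → length u + i ≤ m → x m u ≡ proj₁ (lim u)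
        lim≡ u m u+i≤m =
          subst (λ j → x j u ≡ proj₁ (lim u)) (m∸n+n≡m (m+n≤o⇒n≤o (length u) u+i≤m))
            (lim-over
              (λ n → subst (λ θ → x (n + i) ∈ Answer θ) (threads-orbit n)
                       (x∈ (n + i) (aged n)))
              u (m ∸ i) (m+n≤o⇒m≤o∸n (length u) u+i≤m))

      -- All limits have the same projection, so the thread of the first move can supply the common
      -- point.
      first : Tree (A × 𝟚)
      first = Track.lim 1 zero

      wins : ∃ λ t → ∀ i → t ∈ reply strategy p i
      wins = proj₁ ∘ first , λ i k →
        let open Track (suc i) k in
        lim , lim∈Committed , λ u →
          -- By round `m` both limits are settled at `u`, so both project to the label of `x m`
          -- there.
          let m = (length u + suc i) ⊔ (length u + 1)
          in trans (sym (lim≡ u m (m≤m⊔n _ _)))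
                   (Track.lim≡ 1 zero u m (m≤n⊔m (length u + suc i) _))

  winning : Winning strategy
  winning = record { legal = Play.legal ; wins = λ p legal₁ → Play.Won.wins p legal₁ }

-- Codes from the properties of the basis

theorem4p1 : ExcludedMiddle 1ℓ →
    (τ 𝔹 : Family) →
    (∀ {A} (a : IsAlphabet A) → IsTopology (τ A a)) →
    (∀ {A} (a : IsAlphabet A) → IsBasis (τ A a) (𝔹 A a)) →
    (P1 : ∀ {A} (a : IsAlphabet A) (s : FinTree A) → 𝔹 A a (N s)) →
    (P2 : ∀ {A} (a : IsAlphabet A) {V W : TreeSet A} → 𝔹 A a V → 𝔹 A a W →
    𝔹 A a (V ∪ W) × 𝔹 A a (V ∩ W)) →
    (P3 : ∀ {A B} (a : IsAlphabet A) (b : IsAlphabet B) {L : TreeSet (A × B)} →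
    𝔹 (A × B) (a ×-alphabet b) L → 𝔹 A a π₀[ L ]) →
    (P4 : ∀ {A} (a : IsAlphabet A) {L : TreeSet A} → 𝔹 A a L →
    ∃ λ (C : TreeSet (A × 𝟚)) →
    𝔹 (A × 𝟚) (a ×-alphabet 𝟚-alphabet) C ×
    C ⊆ T×𝕋∞ ×
    (∃ λ (F : TreeSet (A × 𝟚)) → CantorClosed F × C ≐ F ∩ T×𝕋∞) ×
    L ≐ π₀[ C ]) →
    ∀ {A} (a : IsAlphabet A) → IsStrongChoquet (τ A a)
theorem4p1 em τ 𝔹 isTopology isBasis P1 P2 P3 P4 {A} a@(n , 2≤n , A↔Fin) =
  (λ _ → Inverse.from A↔Fin (fromℕ< (≤-trans (s≤s z≤n) 2≤n))) , strategy , winning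
  where
  a×𝟚 = a ×-alphabet 𝟚-alphabet

  -- (P4) presents a basic neighbourhood inside `O`; cutting its code with `N s` stays basic by (P1)
  -- and (P2), and (P3) projects the result.
  encode : ∀ {O x} → τ A a O → x ∈ O →
           ∃ λ (c : Code (τ A a)) → x ∈ π₀[ Code.set c ] × π₀[ Code.set c ] ⊆ O
  encode {x = x} O-open x∈O =
    let L , L∈𝔹 , x∈L , L⊆O = IsBasis.refine (isBasis a) O-open x x∈O
        C , C∈𝔹 , _ , (F , F-closed , C≐) , L⊆πC , πC⊆L = P4 a L∈𝔹
    in record
         { set         = C
         ; hull        = F
         ; hull-closed = F-closed
         ; set≐        = C≐
         ; π₀-open     = λ s → IsBasis.isOpen (isBasis a)
                           (P3 a 𝟚-alphabet (proj₂ (P2 a×𝟚 C∈𝔹 (P1 a×𝟚 s))))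
         } , L⊆πC x∈L , L⊆O ∘ πC⊆L

  open Strategy (τ A a) (isTopology a) em encode using (strategy; winning)
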